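{- For every graph $G$ with average degree $d(G)$, $$\mathrm{pw}(L(G)) \geq \mathrm{tw}(L(G)) > \tfrac{1}{8}d(G)^2 + \tfrac{3}{4}d(G) - 2.$$
   Context: Graphs are finite, simple and undirected, and $G$ has at least one vertex. The average degree is $d(G)=2|E(G)|/|V(G)|$. The line graph $L(G)$ has vertex set $E(G)$, two distinct elements being adjacent if and only if the corresponding edges of $G$ share an endpoint. A tree decomposition of a graph $H$ is a (nonempty) tree $T$ together with a collection of subsets of $V(H)$ (bags) indexed by the nodes of $T$ such that: every vertex of $H$ is in at least one bag; for each vertex $v$ of $H$, the nodes whose bags contain $v$ induce a connected subtree of $T$; and for each edge of $H$ some bag contains both its endpoints. Its width is the size of the largest bag minus 1. The treewidth $\mathrm{tw}(H)$ is the minimum width of a tree decomposition of $H$; the pathwidth $\mathrm{pw}(H)$ is the minimum width over tree decompositions whose tree $T$ is a path. (If $H$ has no vertices, $\mathrm{tw}(H)=\mathrm{pw}(H)=-1$.) -}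

module Defs where

open import Level using (Level; 0ℓ)
open import Data.Empty using (⊥)
open import Data.Fin.Base using (Fin; zero; suc; toℕ; _<_)
open import Data.Fin.Permutation using (Permutation′; _⟨$⟩ʳ_; id)
open import Data.Fin.Properties using (_≟_; _<?_; any?)
open import Data.Fin.Subset using (Subset; _∈_; ∣_∣; ⊤)
open import Data.Fin.Subset.Properties using (∈⊤)
open import Data.Integer.Base as ℤ using (ℤ; +_)
import Data.Integer.Properties as ℤₚ
open import Data.List.Base
  using (List; []; _∷_; _++_; length; lookup; filter; tabulate; allFin; cartesianProduct)
open import Data.List.Extrema.Nat using (max)
open import Data.List.Relation.Unary.Linked using (Linked; _∷_)
open import Data.List.Relation.Unary.Unique.Propositional using (Unique)
open import Data.Nat.Base as ℕ using (ℕ; NonZero)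
open import Data.Nat.Induction using (<-rec)
import Data.Nat.Properties as ℕₚ
open import Data.Product.Base using (Σ; ∃; ∃-syntax; _×_; _,_; proj₁; proj₂)
open import Data.Rational.Base as ℚ using (ℚ)
open import Data.Sum.Base using (_⊎_; inj₁; inj₂)
open import Function.Base using (_∘_)
open import Function.Bundles using (_⇔_; mk⇔)
open import Relation.Binary.Construct.Closure.ReflexiveTransitive using (Star; ε)
open import Relation.Binary.Core using (Rel)
open import Relation.Binary.Definitions using (Decidable; Symmetric; Irreflexive)
open import Relation.Binary.PropositionalEquality using (_≡_; _≢_; refl; sym)
open import Relation.Nullary using (¬_; ¬?; yes; no)
open import Relation.Nullary.Decidable using (_×-dec_; _⊎-dec_)
open import Relation.Unary using (Pred; U)

private variable
  ℓ : Level
  n : ℕ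

-- Finite graphs are taken up to isomorphism: the vertex set is Fin n.
record Graph (n : ℕ) : Set₁ where
  field
    Adj        : Rel (Fin n) 0ℓ
    adj?       : Decidable Adj
    adj-sym    : Symmetric Adj
    adj-irrefl : Irreflexive _≡_ Adj

open Graph public

-- Each edge is listed exactly once, with its smaller endpoint first.
edges : Graph n → List (Fin n × Fin n)
edges {n} G =
  filter (λ (u , v) → (u <? v) ×-dec adj? G u v)
         (cartesianProduct (allFin n) (allFin n))

∣E_∣ : Graph n → ℕ
∣E G ∣ = length (edges G)

averageDegree : .{{_ : NonZero n}} → Graph n → ℚ
averageDegree {n} G = (+ (2 ℕ.* ∣E G ∣)) ℚ./ n

EndpointOf : Fin n → Fin n × Fin n → Set
EndpointOf x (u , v) = x ≡ u ⊎ x ≡ v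

ShareEndpoint : Rel (Fin n × Fin n) 0ℓ
ShareEndpoint e f = ∃[ x ] EndpointOf x e × EndpointOf x f

endpointOf? : Decidable (EndpointOf {n})
endpointOf? x (u , v) = (x ≟ u) ⊎-dec (x ≟ v)

shareEndpoint? : Decidable (ShareEndpoint {n})
shareEndpoint? e f = any? λ x → endpointOf? x e ×-dec endpointOf? x f

-- The vertex i of the line graph stands for the i-th entry of edges G.
L : (G : Graph n) → Graph ∣E G ∣
L G = record
  { Adj        = λ i j → i ≢ j × ShareEndpoint (lookup (edges G) i) (lookup (edges G) j)
  ; adj?       = λ i j → ¬? (i ≟ j) ×-dec shareEndpoint? _ _
  ; adj-sym    = λ (i≢j , x , x∈i , x∈j) → i≢j ∘ sym , x , x∈j , x∈i
  ; adj-irrefl = λ i≡j (i≢j , _) → i≢j i≡j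
  }

-- The subgraph induced by P is connected (or empty): every two vertices
-- of P are joined by a walk that stays inside P.
ConnectedOn : Graph n → Pred (Fin n) ℓ → Set ℓ
ConnectedOn G P =
  ∀ {s t} → P s → P t → Star (λ a b → P a × P b × Adj G a b) s t

-- The cycle u, x₁, …, xₖ, u, where k ≥ 2.
IsCycle : Graph n → Fin n → List (Fin n) → Set
IsCycle G u xs =
  2 ℕ.≤ length xs × Unique (u ∷ xs) × Linked (Adj G) (u ∷ xs ++ u ∷ [])

record IsTree (G : Graph n) : Set where
  field
    nonempty  : NonZero n
    connected : ConnectedOn G U
    acyclic   : ∀ u xs → ¬ IsCycle G u xs

Consecutive : ℕ → ℕ → Set
Consecutive a b = ℕ.suc a ≡ b ⊎ ℕ.suc b ≡ a

-- The vertices can be numbered so that adjacent means consecutive.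
IsPath : Graph n → Set
IsPath {n} G =
  Σ (Permutation′ n) λ π →
    ∀ i j → Adj G i j ⇔ Consecutive (toℕ (π ⟨$⟩ʳ i)) (toℕ (π ⟨$⟩ʳ j))

record TreeDecomposition (H : Graph n) : Set₁ where
  field
    {order}   : ℕ
    tree      : Graph order
    isTree    : IsTree tree
    bag       : Fin order → Subset n
    covers    : ∀ v → ∃[ t ] v ∈ bag t
    connected : ∀ v → ConnectedOn tree (λ t → v ∈ bag t)
    edge-in   : ∀ {u v} → Adj H u v → ∃[ t ] (u ∈ bag t × v ∈ bag t)

  maxBagSize : ℕ
  maxBagSize = max 0 (tabulate (λ t → ∣ bag t ∣))

  width : ℤ
  width = + maxBagSize ℤ.- + 1

PathDecomposition : Graph n → Set₁
PathDecomposition H = Σ (TreeDecomposition H) (IsPath ∘ TreeDecomposition.tree)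

IsMinimumOf : {A : Set ℓ} → (A → ℤ) → ℤ → Set ℓ
IsMinimumOf f k = (∃[ a ] f a ≡ k) × (∀ a → k ℤ.≤ f a)

-- tw(H) = k and pw(H) = k, as relations: a minimum over an infinite family
-- is not directly a computable function.  The lemmas below show that these
-- relations are single-valued, and that a value cannot fail to exist.
IsTreewidth : Graph n → ℤ → Set₁
IsTreewidth H = IsMinimumOf {A = TreeDecomposition H} TreeDecomposition.width

IsPathwidth : Graph n → ℤ → Set₁
IsPathwidth H =
  IsMinimumOf {A = PathDecomposition H} (TreeDecomposition.width ∘ proj₁)

minimum-unique : {A : Set ℓ} (f : A → ℤ) {j k : ℤ} →
                 IsMinimumOf f j → IsMinimumOf f k → j ≡ k
minimum-unique f ((a , refl) , a-min) ((b , refl) , b-min) =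
  ℤₚ.≤-antisym (a-min b) (b-min a)

minimum-exists : {A : Set ℓ} (f : A → ℕ) → A →
                 ¬ ¬ (∃[ k ] IsMinimumOf (λ a → + f a ℤ.- + 1) k)
minimum-exists {A = A} f a₀ none = <-rec (λ m → ∀ a → f a ≡ m → ⊥) step (f a₀) a₀ refl
  where
  step : ∀ m → (∀ {k} → k ℕ.< m → ∀ a → f a ≡ k → ⊥) → ∀ a → f a ≡ m → ⊥
  step _ rec a refl = none
    ( _ , (a , refl)
    , λ b → ℤₚ.+-monoˡ-≤ (ℤ.- + 1)
              (ℤ.+≤+ (ℕₚ.≮⇒≥ λ fb<fa → rec fb<fa b refl)) )

trivialPathDecomposition : (H : Graph n) → PathDecomposition H
trivialPathDecomposition {n} H = decomposition , id , λ where
    zero zero → mk⇔ (λ ()) λ { (inj₁ ()) ; (inj₂ ()) }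
  where
  K₁ : Graph 1
  K₁ = record
    { Adj        = λ _ _ → ⊥
    ; adj?       = λ _ _ → no λ ()
    ; adj-sym    = λ ()
    ; adj-irrefl = λ _ ()
    }

  decomposition : TreeDecomposition H
  decomposition = record
    { tree      = K₁
    ; isTree    = record
      { nonempty  = _
      ; connected = λ { {zero} {zero} _ _ → ε }
      ; acyclic   = λ { _ [] (() , _) ; _ (_ ∷ _) (_ , _ , () ∷ _) }
      }
    ; bag       = λ _ → ⊤
    ; covers    = λ _ → zero , ∈⊤
    ; connected = λ { _ {zero} {zero} _ _ → ε }
    ; edge-in   = λ _ → zero , ∈⊤ , ∈⊤
    }

treewidth-exists : (H : Graph n) → ¬ ¬ (∃[ k ] IsTreewidth H k)
treewidth-exists H =
  minimum-exists TreeDecomposition.maxBagSize (proj₁ (trivialPathDecomposition H))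

pathwidth-exists : (H : Graph n) → ¬ ¬ (∃[ k ] IsPathwidth H k)
pathwidth-exists H =
  minimum-exists (TreeDecomposition.maxBagSize ∘ proj₁) (trivialPathDecomposition H)

module Submission where

-- Fix a tree decomposition of L(G) with tree T and put q = ⌊d/2⌋, where d is the
-- average degree.  Choose U ⊆ V(G) minimal among the nonempty sets spanning at
-- least d|U|/2 edges; then |U| > q, and at least d|S|/2 edges inside U meet S for
-- every nonempty S ⊆ U.
--
-- For a node t and a vertex v, the edges at v missing from the bag of t all live
-- in one component of T − t, since any two of them share a bag; its node adjacent
-- to t is the label of v at t.  Walking through T without turning back, one finds
-- t and p such that the set S of vertices of U not labelled p at t has more than q
-- elements, while for every other label at most q vertices of S bear it.  An edge
-- inside U that meets S is either in the bag of t or joins two vertices of S with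
-- the same label.  Counting pairs of the latter kind, with a separate estimate
-- when |S| = q + 1, bounds the bag from below by (q(d + 1 − q) + d) / 2.

open import Defs
open import Data.Nat.Base using (ℕ; NonZero)
open import Data.Product.Base using (_×_)

open import Data.Fin.Base as Fin using (Fin; zero; suc)
open import Data.Fin.Properties using (_≟_; any?)
open import Data.List.Base using (List; []; _∷_; _++_; length; lookup)
open import Data.Maybe.Base using (Maybe; just; nothing)
open import Data.Maybe.Properties using (just-injective; ≡-dec)
open import Data.Nat.Base as ℕ using (zero; suc; z≤n; s≤s)
import Data.Nat.Properties as ℕₚ
open import Data.Product.Base using (∃-syntax; _,_; proj₁; proj₂; uncurry)
open import Data.Sum.Base using (_⊎_; inj₁; inj₂)
open import Function.Base using (_∘_; id; flip)
open import Level using (Level)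
open import Relation.Binary.Definitions using (Decidable)
open import Relation.Binary.PropositionalEquality
  using (_≡_; _≢_; refl; sym; trans; cong; cong₂; subst; subst₂; ≢-sym; module ≡-Reasoning)
open import Relation.Nullary using (¬_; ¬?; Dec; does; yes; no; contradiction)
open import Relation.Nullary.Decidable using (_×-dec_; _⊎-dec_; dec-true)
open import Relation.Unary using (Pred) renaming (Decidable to Decidable₁)

private variable
  a ℓ ℓ′ ℓ″ : Level
  n N : ℕ

-- Walks in trees: loop erasure, separation and the non-backtracking search.

module TreeWalks where
  open import Data.Fin.Properties using (injective⇒≤)
  open import Data.List.Membership.Propositional using (_∈_; _∉_)
  open import Data.List.Membership.Propositional.Properties using (∈-lookup)
  open import Data.List.Membership.DecPropositional using () renaming (_∈?_ to member?)
  open import Data.List.Relation.Unary.All as All using (All; []; _∷_)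
  open import Data.List.Relation.Unary.All.Properties using (¬Any⇒All¬)
  open import Data.List.Relation.Unary.AllPairs using ([]; _∷_)
  open import Data.List.Relation.Unary.Any using (here; there)
  open import Data.List.Relation.Unary.Linked using (Linked; [-]; _∷_)
  open import Data.List.Relation.Unary.Unique.Propositional using (Unique)
  open import Data.Nat.Base using (_+_; _≤_)
  open import Relation.Binary.Construct.Closure.ReflexiveTransitive
    using (Star; ε; _◅_; reverse) renaming (map to mapStar)

  lookup-injective : {A : Set a} {xs : List A} → Unique xs →
                     ∀ {i j} → lookup xs i ≡ lookup xs j → i ≡ j
  lookup-injective {xs = _ ∷ _}  _          {zero}  {zero}  _  = refl
  lookup-injective {xs = _ ∷ xs} (x∉ ∷ _)   {zero}  {suc j} eq =
    contradiction eq (All.lookup x∉ (∈-lookup {xs = xs} j))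
  lookup-injective {xs = _ ∷ xs} (x∉ ∷ _)   {suc i} {zero}  eq =
    contradiction (sym eq) (All.lookup x∉ (∈-lookup {xs = xs} i))
  lookup-injective {xs = _ ∷ _}  (_ ∷ uniq) {suc i} {suc j} eq =
    cong suc (lookup-injective uniq eq)

  unique-length : {xs : List (Fin n)} → Unique xs → length xs ≤ n
  unique-length uniq = injective⇒≤ (lookup-injective uniq)

  Walk : Graph n → Pred (Fin n) ℓ → Fin n → Fin n → Set ℓ
  Walk G P = Star λ a b → P a × P b × Adj G a b

  module _ (T : Graph N) where

    Walk-map : {P : Pred (Fin N) ℓ} {Q : Pred (Fin N) ℓ′} → (∀ {a} → P a → Q a) →
               ∀ {s t} → Walk T P s t → Walk T Q s t
    Walk-map f = mapStar λ (Pa , Pb , ab) → f Pa , f Pb , ab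

    Walk-sym : {P : Pred (Fin N) ℓ} → ∀ {s t} → Walk T P s t → Walk T P t s
    Walk-sym = reverse λ (Pa , Pb , ab) → Pb , Pa , adj-sym T ab

    -- Cut the walk at its first arrival at `t`: the node just before is a neighbour of `t`, and the
    -- stretch up to it has not met `t`.
    first-hit : {P : Pred (Fin N) ℓ} → ∀ {s t} → s ≢ t → Walk T P s t →
                ∃[ x ] Adj T t x × P x × Walk T (λ a → P a × a ≢ t) s x
    first-hit s≢t ε = contradiction refl s≢t
    first-hit {s = s} {t} s≢t (_◅_ {j = u} (Ps , Pu , su) w) with u ≟ t
    ... | yes refl = s , adj-sym T su , Ps , ε
    ... | no u≢t with first-hit u≢t w
    ...   | x , tx , Px , w′ = x , tx , Px , ((Ps , s≢t) , (Pu , u≢t) , su) ◅ w′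

    -- The list index holds the nodes after the start, so `z ∷ xs` lists the whole path.
    data Path (y : Fin N) : Fin N → List (Fin N) → Set where
      end  : Path y y []
      step : ∀ {z z′ xs} → Adj T z z′ → Path y z′ xs → Path y z (z′ ∷ xs)

    Path-closed : ∀ {t x y xs} → Path y x xs → Adj T y t →
                  Linked (Adj T) (x ∷ xs ++ t ∷ [])
    Path-closed end        yt = yt ∷ [-]
    Path-closed (step e p) yt = e ∷ Path-closed p yt

    SimplePath : Pred (Fin N) ℓ → Fin N → Fin N → Set ℓ
    SimplePath P z y = ∃[ xs ] Path y z xs × Unique (z ∷ xs) × All P (z ∷ xs)

    SimplePath-from : {P : Pred (Fin N) ℓ} → ∀ {y z xs} → Path y z xs →
      Unique (z ∷ xs) → All P (z ∷ xs) → ∀ {u} → u ∈ z ∷ xs → SimplePath P u y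
    SimplePath-from p          uniq       all       (here refl) = _ , p , uniq , all
    SimplePath-from (step _ p) (_ ∷ uniq) (_ ∷ all) (there u∈)  = SimplePath-from p uniq all u∈

    -- If the new start already lies on the simple path built so far, only the stretch from that
    -- occurrence is kept. An empty walk carries no proof of `P`, hence the argument `P y`.
    loop-erase : {P : Pred (Fin N) ℓ} → ∀ {x y} → P y → Walk T P x y → SimplePath P x y
    loop-erase Py ε = [] , end , [] ∷ [] , Py ∷ []
    loop-erase {x = x} Py ((Px , Pu , xu) ◅ w) with loop-erase Py w
    ... | xs , p , uniq , all with member? _≟_ x (_ ∷ xs)
    ...   | yes x∈ = SimplePath-from p uniq all x∈
    ...   | no  x∉ = _ , step xu p , ¬Any⇒All¬ _ x∉ ∷ uniq , Px ∷ all

    Linked⇒Walk : {P : Pred (Fin N) ℓ} → ∀ {p xs x} → Linked (Adj T) (p ∷ xs) →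
                  All P (p ∷ xs) → x ∈ p ∷ xs → Walk T P p x
    Linked⇒Walk _            _                (here refl) = ε
    Linked⇒Walk (pq ∷ links) (Pp ∷ Pq ∷ all) (there x∈)  =
      (Pp , Pq , pq) ◅ Linked⇒Walk links (Pq ∷ all) x∈

    module _ (acyclic : ∀ u xs → ¬ IsCycle T u xs) where

      -- Loop erasure would turn such a walk into a simple path from `x` to `y`, which the two edges
      -- at `t` close to a cycle.
      neighbours-separated : ∀ {t x y} → Adj T t x → Adj T t y → x ≢ y →
                             ¬ Walk T (_≢ t) x y
      neighbours-separated {t} tx ty x≢y w
        with loop-erase (λ y≡t → adj-irrefl T (sym y≡t) ty) w
      ... | []     , end , _            = x≢y refl
      ... | z ∷ zs , p   , uniq , avoid = acyclic t (_ ∷ z ∷ zs)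
        ( s≤s (s≤s z≤n)
        , All.map ≢-sym avoid ∷ uniq
        , tx ∷ Path-closed p (adj-sym T ty) )

      -- Walks are listed newest node first. At the start the default is `t` itself, which is no
      -- neighbour of `t` and so rules out no continuation.
      previous : Fin N → List (Fin N) → Fin N
      previous t []      = t
      previous _ (p ∷ _) = p

      -- Had `x` been visited before the previous node `p`, the stretch of the walk between `p` and
      -- `x` would join two neighbours of `t` while avoiding `t`.
      next-fresh : ∀ {t xs x} → Linked (Adj T) (t ∷ xs) → Unique (t ∷ xs) →
                   Adj T t x → x ≢ previous t xs → x ∉ t ∷ xs
      next-fresh _           _        tx _   (here refl)         = adj-irrefl T refl tx
      next-fresh _           _        _  x≢p (there (here refl)) = x≢p refl
      next-fresh (tp ∷ links) (t∉ ∷ _) tx x≢p (there (there x∈)) =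
        neighbours-separated tp tx (≢-sym x≢p)
          (Linked⇒Walk links (All.map ≢-sym t∉) (there x∈))

      -- A walk in T that never turns back visits no node twice, hence it stops.
      -- Heavy t p is about a walk that entered t from p, Heavy r r about its start.
      non-backtracking-search : {Heavy : Fin N → Fin N → Set ℓ} →
        (∀ t p → Dec (Heavy t p)) → (∃[ r ] Heavy r r) →
        ∃[ t ] ∃[ p ] Heavy t p × (∀ {x} → Adj T t x → x ≢ p → ¬ Heavy x t)
      non-backtracking-search {Heavy = Heavy} heavy? (r , r-heavy) =
        go N [] [-] ([] ∷ []) (ℕₚ.m≤m+n N 0) r-heavy
        where
        go : ∀ k {t} xs → Linked (Adj T) (t ∷ xs) → Unique (t ∷ xs) → N ≤ k + length xs →
             Heavy t (previous t xs) →
             ∃[ t ] ∃[ p ] Heavy t p × (∀ {x} → Adj T t x → x ≢ p → ¬ Heavy x t)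
        -- Here `N ≤ length xs`, but the distinct nodes `t ∷ xs` number one more.
        go zero xs _ uniq N≤ _ = contradiction (unique-length uniq) (ℕₚ.≤⇒≯ N≤)
        go (suc k) {t} xs links uniq N≤ t-heavy
          with any? (λ x → adj? T t x ×-dec ¬? (x ≟ previous t xs) ×-dec heavy? x t)
        ... | no none = t , _ , t-heavy , λ tx x≢p x-heavy → none (_ , tx , x≢p , x-heavy)
        ... | yes (x , tx , x≢p , x-heavy) =
          go k (t ∷ xs) (adj-sym T tx ∷ links)
             (¬Any⇒All¬ _ (next-fresh links uniq tx x≢p) ∷ uniq)
             (subst (N ≤_) (sym (ℕₚ.+-suc k _)) N≤) x-heavy

-- Labels of vertices at the nodes of the decomposition tree.

module Labelling (G : Graph n) (td : TreeDecomposition (L G)) where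
  open TreeWalks
  open TreeDecomposition td
  open IsTree isTree using (acyclic) renaming (connected to tree-connected)
  import Data.Fin.Subset as Subset
  open import Data.Fin.Subset.Properties using (_∈?_)
  open import Relation.Binary.Construct.Closure.ReflexiveTransitive using (_◅◅_)

  Node : Set
  Node = Fin order

  Edge : Set
  Edge = Fin ∣E G ∣

  _∈ᵇ_ : Edge → Node → Set
  e ∈ᵇ t = e Subset.∈ bag t

  _∉ᵇ_ : Edge → Node → Set
  e ∉ᵇ t = ¬ e ∈ᵇ t

  _At_ : Fin n → Edge → Set
  v At e = EndpointOf v (lookup (edges G) e)

  -- Distinct edges at `v` are adjacent in the line graph; a single edge is covered by some bag.
  common-bag : ∀ {e f v} → v At e → v At f → ∃[ t ] e ∈ᵇ t × f ∈ᵇ t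
  common-bag {e} {f} v∈e v∈f with e ≟ f
  ... | yes refl = let t , e∈t = covers e in t , e∈t , e∈t
  ... | no  e≢f  = edge-in (e≢f , _ , v∈e , v∈f)

  -- The bags containing e lie in the component of T − t that contains the
  -- neighbour x of t.
  record Side (t x : Node) (e : Edge) : Set where
    field
      neighbour : Adj tree t x
      outside   : e ∉ᵇ t
      {home}    : Node
      e∈home    : e ∈ᵇ home
      path      : Walk tree (_≢ t) x home

  open Side

  -- The nodes whose bags contain `e` are connected in the tree, and `t` is not among them.
  bag-walk : ∀ {e s m t} → e ∈ᵇ s → e ∈ᵇ m → e ∉ᵇ t → Walk tree (_≢ t) s m
  bag-walk {e} e∈s e∈m e∉t =
    Walk-map tree (λ { e∈t refl → e∉t e∈t }) (connected e e∈s e∈m)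

  side-walk : ∀ {t x e m} → Side t x e → e ∈ᵇ m → Walk tree (_≢ t) x m
  side-walk sd e∈m = path sd ◅◅ bag-walk (e∈home sd) e∈m (outside sd)

  side-exists : ∀ {t e} → e ∉ᵇ t → ∃[ x ] Side t x e
  side-exists {t} {e} e∉t =
    let s , e∈s = covers e
        x , tx , _ , w = first-hit tree (λ { refl → e∉t e∈s }) (tree-connected {s} {t} _ _)
    in x , record
      { neighbour = tx
      ; outside   = e∉t
      ; e∈home    = e∈s
      ; path      = Walk-sym tree (Walk-map tree proj₂ w)
      }

  -- The two edges share a bag, so otherwise distinct neighbours `x` and `y` of `t` would be joined
  -- through it without meeting `t`.
  side-unique : ∀ {t x y e f v} → v At e → v At f → Side t x e → Side t y f → x ≡ y
  side-unique {x = x} {y} v∈e v∈f sd sd′ with x ≟ y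
  ... | yes x≡y = x≡y
  ... | no  x≢y =
    let _ , e∈m , f∈m = common-bag v∈e v∈f in
    contradiction (side-walk sd e∈m ◅◅ Walk-sym tree (side-walk sd′ f∈m))
      (neighbours-separated tree acyclic (neighbour sd) (neighbour sd′) x≢y)

  -- Let `m` be a common bag of both edges. From `x` one reaches `m` avoiding `t`; from `m` one
  -- reaches `t` avoiding `x`, hence enters `t` through another neighbour `y`. Together these join
  -- `x` to `y` around `t`.
  side-opposite : ∀ {t x e f v} → v At e → v At f → Side t x e → ¬ Side x t f
  side-opposite {t} {x} v∈e v∈f sd sd′ =
    let m , e∈m , f∈m = common-bag v∈e v∈f
        y , ty , y≢x , w = first-hit tree (λ { refl → outside sd e∈m })
                             (Walk-sym tree (side-walk sd′ f∈m))
    in neighbours-separated tree acyclic (neighbour sd) ty (≢-sym y≢x)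
         (side-walk sd e∈m ◅◅ Walk-map tree proj₂ w)

  -- nothing if all edges at v are in the bag of t
  label : Node → Fin n → Maybe Node
  label t v with any? (λ e → endpointOf? v (lookup (edges G) e) ×-dec ¬? (e ∈? bag t))
  ... | yes (_ , _ , e∉t) = just (proj₁ (side-exists e∉t))
  ... | no  _             = nothing

  label-side : ∀ {t v x} → label t v ≡ just x → ∃[ e ] v At e × Side t x e
  label-side {t} {v} eq
    with yes (e , v∈e , e∉t) ←
      any? (λ e → endpointOf? v (lookup (edges G) e) ×-dec ¬? (e ∈? bag t))
    with refl ← eq = e , v∈e , proj₂ (side-exists e∉t)

  -- `label` looks at an arbitrary missing edge at `v`; by `side-unique` every other missing edge at
  -- `v` gives the same answer.
  side-label : ∀ {t v x e} → v At e → Side t x e → label t v ≡ just x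
  side-label {t} {v} v∈e sd
    with any? (λ e → endpointOf? v (lookup (edges G) e) ×-dec ¬? (e ∈? bag t))
  ... | yes (_ , v∈f , f∉t) = cong just (side-unique v∈f v∈e (proj₂ (side-exists f∉t)) sd)
  ... | no none             = contradiction (_ , v∈e , outside sd) none

  label-neighbour : ∀ {t v x} → label t v ≡ just x → Adj tree t x
  label-neighbour eq = let _ , _ , sd = label-side eq in neighbour sd

  -- This lets lightness at a neighbour `x` of `t` bound the number of vertices labelled `x` at `t`.
  label-opposite : ∀ {t v x} → label t v ≡ just x → label x v ≢ just t
  label-opposite eq eq′ =
    let _ , v∈e , sd  = label-side eq
        _ , v∈f , sd′ = label-side eq′
    in side-opposite v∈e v∈f sd sd′

-- Counting with indicator sums.

module Counting where
  open import Algebra.Properties.CommutativeMonoid.Sum ℕₚ.+-0-commutativeMonoid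
    using (sum; ∑-distrib-+; ∑-comm; sum-cong-≗) public
  open import Algebra.Properties.Semiring.Sum ℕₚ.+-*-semiring using (*-distribʳ-sum)
  open import Data.Bool.Base using (if_then_else_; true; false)
  open import Data.Fin.Properties using (<⇒≢; <-asym; _<?_)
  open import Data.Fin.Subset using (Subset; ∣_∣)
  open import Data.Fin.Subset.Properties using (_∈?_; drop-there)
  open import Data.List.Base using (filter; map; allFin; tabulate; cartesianProduct)
  open import Data.List.Properties using (map-++; map-∘; map-tabulate)
  open import Data.Nat.Base using (_+_; _*_; _≤_; _<_)
  open import Data.Nat.ListAction using () renaming (sum to sumᴸ)
  open import Data.Nat.ListAction.Properties using (sum-++)
  open import Data.Vec.Base using ([]; _∷_)

  -- The Iverson bracket.
  ⟦_⟧ : {P : Set ℓ} → Dec P → ℕ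
  ⟦ P? ⟧ = if does P? then 1 else 0

  ⟦⟧-mono : {P : Set ℓ} {Q : Set ℓ′} → (P → Q) → (P? : Dec P) (Q? : Dec Q) → ⟦ P? ⟧ ≤ ⟦ Q? ⟧
  ⟦⟧-mono f (no  _) _       = z≤n
  ⟦⟧-mono f (yes _) (yes _) = s≤s z≤n
  ⟦⟧-mono f (yes x) (no ¬q) = contradiction (f x) ¬q

  module _ {P : Set ℓ} {Q : Set ℓ′} {R : Set ℓ″} where

    ⟦⟧-split : (P → Q ⊎ R) → (P? : Dec P) (Q? : Dec Q) (R? : Dec R) → ⟦ P? ⟧ ≤ ⟦ Q? ⟧ + ⟦ R? ⟧
    ⟦⟧-split f (no _)  _       _       = z≤n
    ⟦⟧-split f (yes _) (yes _) _       = s≤s z≤n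
    ⟦⟧-split f (yes _) (no _)  (yes _) = s≤s z≤n
    ⟦⟧-split f (yes x) (no ¬q) (no ¬r) with f x
    ... | inj₁ y = contradiction y ¬q
    ... | inj₂ z = contradiction z ¬r

    ⟦⟧-disjoint : (P → R) → (Q → R) → (P → ¬ Q) →
                  (P? : Dec P) (Q? : Dec Q) (R? : Dec R) → ⟦ P? ⟧ + ⟦ Q? ⟧ ≤ ⟦ R? ⟧
    ⟦⟧-disjoint f g h (no _)  (no _)  _       = z≤n
    ⟦⟧-disjoint f g h (yes x) (yes y) _       = contradiction y (h x)
    ⟦⟧-disjoint f g h (yes x) (no _)  (yes _) = s≤s z≤n
    ⟦⟧-disjoint f g h (yes x) (no _)  (no ¬r) = contradiction (f x) ¬r
    ⟦⟧-disjoint f g h (no _)  (yes y) (yes _) = s≤s z≤n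
    ⟦⟧-disjoint f g h (no _)  (yes y) (no ¬r) = contradiction (g y) ¬r

  sum-mono : {f g : Fin n → ℕ} → (∀ i → f i ≤ g i) → sum f ≤ sum g
  sum-mono {zero}  _   = z≤n
  sum-mono {suc n} f≤g = ℕₚ.+-mono-≤ (f≤g zero) (sum-mono (f≤g ∘ suc))

  # : {P : Pred (Fin n) ℓ} → Decidable₁ P → ℕ
  # P? = sum λ i → ⟦ P? i ⟧

  module _ {P : Pred (Fin n) ℓ} {Q : Pred (Fin n) ℓ′} {R : Pred (Fin n) ℓ″} where

    #-split : (∀ {i} → P i → Q i ⊎ R i) →
              (P? : Decidable₁ P) (Q? : Decidable₁ Q) (R? : Decidable₁ R) → # P? ≤ # Q? + # R?
    #-split f P? Q? R? = ℕₚ.≤-trans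
      (sum-mono λ i → ⟦⟧-split f (P? i) (Q? i) (R? i))
      (ℕₚ.≤-reflexive (∑-distrib-+ (λ i → ⟦ Q? i ⟧) (λ i → ⟦ R? i ⟧)))

    #-disjoint : (∀ {i} → P i → R i) → (∀ {i} → Q i → R i) → (∀ {i} → P i → ¬ Q i) →
                 (P? : Decidable₁ P) (Q? : Decidable₁ Q) (R? : Decidable₁ R) → # P? + # Q? ≤ # R?
    #-disjoint f g h P? Q? R? = ℕₚ.≤-trans
      (ℕₚ.≤-reflexive (sym (∑-distrib-+ (λ i → ⟦ P? i ⟧) (λ i → ⟦ Q? i ⟧))))
      (sum-mono λ i → ⟦⟧-disjoint f g h (P? i) (Q? i) (R? i))

  #-empty : {P : Pred (Fin n) ℓ} (P? : Decidable₁ P) → (∀ i → ¬ P i) → # P? ≡ 0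
  #-empty {zero}  P? ¬P = refl
  #-empty {suc n} P? ¬P with P? zero
  ... | yes P0 = contradiction P0 (¬P zero)
  ... | no  _  = #-empty (P? ∘ suc) (¬P ∘ suc)

  #-mono : {P : Pred (Fin n) ℓ} {Q : Pred (Fin n) ℓ′} → (∀ {i} → P i → Q i) →
           (P? : Decidable₁ P) (Q? : Decidable₁ Q) → # P? ≤ # Q?
  #-mono f P? Q? = sum-mono λ i → ⟦⟧-mono f (P? i) (Q? i)

  #-full : {P : Pred (Fin n) ℓ} (P? : Decidable₁ P) → (∀ i → P i) → # P? ≡ n
  #-full {zero}  P? _   = refl
  #-full {suc n} P? all with P? zero
  ... | yes _   = cong suc (#-full (P? ∘ suc) (all ∘ suc))
  ... | no  ¬P0 = contradiction (all zero) ¬P0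

  #-positive : {P : Pred (Fin n) ℓ} (P? : Decidable₁ P) → ∃[ i ] P i → 0 < # P?
  #-positive P? (zero , P0) with P? zero
  ... | yes _   = s≤s z≤n
  ... | no  ¬P0 = contradiction P0 ¬P0
  #-positive P? (suc i , Pi) = ℕₚ.m≤n⇒m≤o+n _ (#-positive (P? ∘ suc) (i , Pi))

  #-inhabited : {P : Pred (Fin n) ℓ} (P? : Decidable₁ P) → 0 < # P? → ∃[ i ] P i
  #-inhabited {suc n} P? 0<# with P? zero
  ... | yes P0 = zero , P0
  ... | no  _  = let i , Pi = #-inhabited (P? ∘ suc) 0<# in suc i , Pi

  #-other : {P : Pred (Fin n) ℓ} (P? : Decidable₁ P) → ∀ {i} → P i →
            # (λ j → ¬? (i ≟ j) ×-dec P? j) < # P?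
  #-other P? {i} Pi = ℕₚ.≤-trans
    (ℕₚ.+-monoˡ-≤ _ (#-positive (i ≟_) (i , refl)))
    (#-disjoint (λ { refl → Pi }) proj₂ (λ i≡j → λ (i≢j , _) → i≢j i≡j)
       (i ≟_) (λ j → ¬? (i ≟ j) ×-dec P? j) P?)

  sum-bound : {P : Pred (Fin n) ℓ} (P? : Decidable₁ P) {f : Fin n → ℕ} {c : ℕ} →
              (∀ {i} → P i → f i ≤ c) → (∀ {i} → ¬ P i → f i ≡ 0) → sum f ≤ # P? * c
  sum-bound P? {f} {c} on off = ℕₚ.≤-trans (sum-mono bound)
    (ℕₚ.≤-reflexive (sym (*-distribʳ-sum c (λ i → ⟦ P? i ⟧))))
    where
    bound : ∀ i → f i ≤ ⟦ P? i ⟧ * c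
    bound i with P? i
    ... | yes Pi = ℕₚ.≤-trans (on Pi) (ℕₚ.≤-reflexive (sym (ℕₚ.+-identityʳ c)))
    ... | no ¬Pi = ℕₚ.≤-reflexive (off ¬Pi)

  #-∈ : (S : Subset n) → # (_∈? S) ≤ ∣ S ∣
  #-∈ []          = z≤n
  #-∈ (true ∷ S)  = s≤s (ℕₚ.≤-trans (#-mono drop-there (λ i → suc i ∈? true ∷ S) (_∈? S)) (#-∈ S))
  #-∈ (false ∷ S) = ℕₚ.≤-trans (#-mono drop-there (λ i → suc i ∈? false ∷ S) (_∈? S)) (#-∈ S)

  sum-lookup : {A : Set a} (f : A → ℕ) (xs : List A) → sum (f ∘ lookup xs) ≡ sumᴸ (map f xs)
  sum-lookup f []       = refl
  sum-lookup f (x ∷ xs) = cong (f x +_) (sum-lookup f xs)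

  sum-filter : {A : Set a} {P : Pred A ℓ} (P? : Decidable₁ P) (f : A → ℕ) (xs : List A) →
               sumᴸ (map f (filter P? xs)) ≡ sumᴸ (map (λ x → ⟦ P? x ⟧ * f x) xs)
  sum-filter P? f []       = refl
  sum-filter P? f (x ∷ xs) with P? x
  ... | yes _ = cong₂ _+_ (sym (ℕₚ.+-identityʳ (f x))) (sum-filter P? f xs)
  ... | no  _ = sum-filter P? f xs

  sum-allFin : (f : Fin n → ℕ) → sumᴸ (map f (allFin n)) ≡ sum f
  sum-allFin f = trans (cong sumᴸ (map-tabulate id f)) (sum-tabulate f)
    where
    sum-tabulate : ∀ {n} (f : Fin n → ℕ) → sumᴸ (tabulate f) ≡ sum f
    sum-tabulate {zero}  f = refl
    sum-tabulate {suc n} f = cong (f zero +_) (sum-tabulate (f ∘ suc))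

  sum-cartesianProduct : {A B : Set a} (f : A × B → ℕ) (xs : List A) (ys : List B) →
    sumᴸ (map f (cartesianProduct xs ys)) ≡ sumᴸ (map (λ x → sumᴸ (map (λ y → f (x , y)) ys)) xs)
  sum-cartesianProduct f []       ys = refl
  sum-cartesianProduct f (x ∷ xs) ys = begin
    sumᴸ (map f (map (x ,_) ys ++ cartesianProduct xs ys))
      ≡⟨ cong sumᴸ (map-++ f (map (x ,_) ys) _) ⟩
    sumᴸ (map f (map (x ,_) ys) ++ map f (cartesianProduct xs ys))
      ≡⟨ sum-++ (map f (map (x ,_) ys)) _ ⟩
    sumᴸ (map f (map (x ,_) ys)) + sumᴸ (map f (cartesianProduct xs ys))
      ≡⟨ cong₂ _+_ (cong sumᴸ (sym (map-∘ ys))) (sum-cartesianProduct f xs ys) ⟩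
    sumᴸ (map (λ y → f (x , y)) ys) + sumᴸ (map (λ x → sumᴸ (map (λ y → f (x , y)) ys)) xs)
      ∎
    where open ≡-Reasoning

  module _ (G : Graph n) {R : Fin n → Fin n → Set ℓ″} (R? : Decidable R) where

    edge-count : # (λ e → uncurry R? (lookup (edges G) e)) ≡
                 sum λ u → sum λ v → ⟦ (u <? v) ×-dec adj? G u v ⟧ * ⟦ R? u v ⟧
    edge-count = begin
      sum (f ∘ lookup (edges G))
        ≡⟨ sum-lookup f (edges G) ⟩
      sumᴸ (map f (edges G))
        ≡⟨ sum-filter E? f (cartesianProduct (allFin n) (allFin n)) ⟩
      sumᴸ (map g (cartesianProduct (allFin n) (allFin n)))
        ≡⟨ sum-cartesianProduct g (allFin n) (allFin n) ⟩
      sumᴸ (map (λ u → sumᴸ (map (λ v → g (u , v)) (allFin n))) (allFin n))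
        ≡⟨ sum-allFin {n = n} _ ⟩
      sum (λ u → sumᴸ (map (λ v → g (u , v)) (allFin n)))
        ≡⟨ sum-cong-≗ {n} (λ u → sum-allFin (λ v → g (u , v))) ⟩
      sum (λ u → sum (λ v → g (u , v)))
        ∎
      where
      open ≡-Reasoning
      f : Fin n × Fin n → ℕ
      f (u , v) = ⟦ R? u v ⟧
      E? : Decidable₁ λ ((u , v) : Fin n × Fin n) → u Fin.< v × Adj G u v
      E? (u , v) = (u <? v) ×-dec adj? G u v
      g : Fin n × Fin n → ℕ
      g uv = ⟦ E? uv ⟧ * f uv

    others : Fin n → ℕ
    others u = # λ v → ¬? (u ≟ v) ×-dec R? u v

    -- Each edge is listed once, smaller end first. Adding the same double sum with its indices
    -- swapped counts both orders, and these are among the ordered pairs of distinct `R`-related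
    -- vertices.
    twice-edge-count : (∀ {u v} → R u v → R v u) →
      2 * # (λ e → uncurry R? (lookup (edges G) e)) ≤ sum others
    twice-edge-count R-sym = begin
      2 * # (λ e → uncurry R? (lookup (edges G) e))
        ≡⟨ cong (2 *_) edge-count ⟩
      2 * sum (λ u → sum (g u))
        ≡⟨ cong (sum (λ u → sum (g u)) +_) (ℕₚ.+-identityʳ _) ⟩
      sum (λ u → sum (g u)) + sum (λ u → sum (g u))
        ≡⟨ cong (sum (λ u → sum (g u)) +_) (∑-comm g) ⟩
      sum (λ u → sum (g u)) + sum (λ u → sum (flip g u))
        ≡⟨ ∑-distrib-+ (λ u → sum (g u)) _ ⟨
      sum (λ u → sum (g u) + sum (flip g u))
        ≡⟨ sum-cong-≗ {n} (λ u → sym (∑-distrib-+ (g u) (flip g u))) ⟩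
      sum (λ u → sum (λ v → g u v + g v u))
        ≤⟨ sum-mono (λ u → sum-mono (pair u)) ⟩
      sum others
        ∎
      where
      open ℕₚ.≤-Reasoning
      g : Fin n → Fin n → ℕ
      g u v = ⟦ (u <? v) ×-dec adj? G u v ⟧ * ⟦ R? u v ⟧

      ⟦⟧-× : {P : Set ℓ} {Q : Set ℓ′} (P? : Dec P) (Q? : Dec Q) →
              ⟦ P? ⟧ * ⟦ Q? ⟧ ≡ ⟦ P? ×-dec Q? ⟧
      ⟦⟧-× (yes _) Q? = ℕₚ.+-identityʳ ⟦ Q? ⟧
      ⟦⟧-× (no  _) _  = refl

      pair : ∀ u v → g u v + g v u ≤ ⟦ ¬? (u ≟ v) ×-dec R? u v ⟧
      pair u v = ℕₚ.≤-trans
        (ℕₚ.≤-reflexive (cong₂ _+_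
          (⟦⟧-× ((u <? v) ×-dec adj? G u v) (R? u v))
          (⟦⟧-× ((v <? u) ×-dec adj? G v u) (R? v u))))
        (⟦⟧-disjoint
          (λ ((u<v , _) , uv) → <⇒≢ u<v , uv)
          (λ ((v<u , _) , vu) → ≢-sym (<⇒≢ v<u) , R-sym vu)
          (λ ((u<v , _) , _) ((v<u , _) , _) → <-asym u<v v<u)
          (((u <? v) ×-dec adj? G u v) ×-dec R? u v)
          (((v <? u) ×-dec adj? G v u) ×-dec R? v u)
          (¬? (u ≟ v) ×-dec R? u v))

-- Minimal dense vertex sets.

module DenseSubsets where
  open Counting
  open import Data.Fin.Subset using (Subset; _∈_; _⊂_; Nonempty; ⊤)
  open import Data.Fin.Subset.Induction using (⊂-wellFounded; Acc; acc)
  open import Data.Fin.Subset.Properties using (_∈?_; anySubset?; nonempty?; _⊂?_; ∈⊤)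
  open import Data.Nat.Base using (pred; _+_; _*_; _≤_; _<_; _/_; >-nonZero; ≢-nonZero⁻¹)
  open import Data.Nat.DivMod using (m/n*n≤m)
  open import Data.Nat.Tactic.RingSolver using (solve-∀)
  open import Data.Vec.Base as Vec using ()
  open import Data.Vec.Properties using (lookup∘tabulate; []=⇒lookup; lookup⇒[]=)

  module _ {P : Pred (Fin n) ℓ} (P? : Decidable₁ P) where

    comprehension : Subset n
    comprehension = Vec.tabulate (does ∘ P?)

    ∈-comprehension⁺ : ∀ {i} → P i → i ∈ comprehension
    ∈-comprehension⁺ {i} Pi =
      lookup⇒[]= i comprehension (trans (lookup∘tabulate (does ∘ P?) i) (dec-true (P? i) Pi))

    ∈-comprehension⁻ : ∀ {i} → i ∈ comprehension → P i
    ∈-comprehension⁻ {i} i∈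
      with P? i | trans (sym (lookup∘tabulate (does ∘ P?) i)) ([]=⇒lookup i∈)
    ... | yes Pi | _ = Pi
    ... | no  _  | ()

  -- Size as an indicator sum, so that the counting lemmas apply directly.
  ∣_∣ᵛ : Subset n → ℕ
  ∣ S ∣ᵛ = # (_∈? S)

  module _ (G : Graph n) where

    inside? : ∀ S → Decidable₁ λ ((u , v) : Fin n × Fin n) → u ∈ S × v ∈ S
    inside? S (u , v) = (u ∈? S) ×-dec (v ∈? S)

    edgesInside : Subset n → ℕ
    edgesInside S = # (inside? S ∘ lookup (edges G))

    -- The bound s(s - 1) on twice the number of edges, with the subtraction moved to the left: each
    -- of the s vertices has at most s - 1 others.
    edgesInside-bound : ∀ S → 2 * edgesInside S + ∣ S ∣ᵛ ≤ ∣ S ∣ᵛ * ∣ S ∣ᵛ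
    edgesInside-bound S with nonempty? S
    ... | no empty = ℕₚ.≤-trans (ℕₚ.≤-reflexive zero-size) z≤n
      where
      zero-size : 2 * edgesInside S + ∣ S ∣ᵛ ≡ 0
      zero-size rewrite #-empty (inside? S ∘ lookup (edges G)) (λ _ (u∈ , _) → empty (_ , u∈))
                      | #-empty (_∈? S) (λ u u∈ → empty (u , u∈)) = refl
    ... | yes nonempty = begin
      2 * edgesInside S + s
        ≤⟨ ℕₚ.+-monoˡ-≤ s
             (twice-edge-count G (λ u v → inside? S (u , v)) λ (u∈ , v∈) → v∈ , u∈) ⟩
      sum (others G (λ u v → inside? S (u , v))) + s
        ≤⟨ ℕₚ.+-monoˡ-≤ s (sum-bound (_∈? S) row off) ⟩
      s * pred s + s               ≡⟨ ℕₚ.+-comm (s * pred s) s ⟩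
      s + s * pred s               ≡⟨ ℕₚ.*-suc s (pred s) ⟨
      s * suc (pred s)
        ≡⟨ cong (s *_) (ℕₚ.suc-pred s {{>-nonZero (#-positive (_∈? S) nonempty)}}) ⟩
      s * s                        ∎
      where
      open ℕₚ.≤-Reasoning
      s : ℕ
      s = ∣ S ∣ᵛ
      row : ∀ {u} → u ∈ S → others G (λ u v → inside? S (u , v)) u ≤ pred s
      row {u} u∈ = ℕₚ.≤-trans
        (#-mono (λ (u≢v , _ , v∈) → u≢v , v∈)
          (λ v → ¬? (u ≟ v) ×-dec inside? S (u , v)) (λ v → ¬? (u ≟ v) ×-dec (v ∈? S)))
        (ℕₚ.<⇒≤pred (#-other (_∈? S) u∈))
      off : ∀ {u} → ¬ u ∈ S → others G (λ u v → inside? S (u , v)) u ≡ 0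
      off {u} u∉ = #-empty (λ v → ¬? (u ≟ v) ×-dec inside? S (u , v)) λ _ (_ , u∈ , _) → u∉ u∈

    -- At least d/2 edges per vertex, cleared of the denominator `n`.
    Dense : Subset n → Set
    Dense S = Nonempty S × ∣E G ∣ * ∣ S ∣ᵛ ≤ n * edgesInside S

    dense? : Decidable₁ Dense
    dense? S = nonempty? S ×-dec ((∣E G ∣ * ∣ S ∣ᵛ) ℕₚ.≤? (n * edgesInside S))

    -- The full vertex set is dense with equality; descend along strict inclusion.
    minimal-dense : .{{_ : NonZero n}} → ∃[ S ] Dense S × (∀ {W} → W ⊂ S → ¬ Dense W)
    minimal-dense = search ⊤ (⊂-wellFounded ⊤) (nonempty , ℕₚ.≤-reflexive balanced)
      where
      nonempty : Nonempty {n} ⊤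
      nonempty = some-vertex , ∈⊤
        where
        some-vertex : Fin n
        some-vertex = Fin.fromℕ< (ℕₚ.n≢0⇒n>0 (≢-nonZero⁻¹ n))

      balanced : ∣E G ∣ * ∣ ⊤ {n} ∣ᵛ ≡ n * edgesInside ⊤
      balanced rewrite #-full {n = n} (_∈? ⊤) (λ _ → ∈⊤)
                     | #-full (inside? ⊤ ∘ lookup (edges G)) (λ _ → ∈⊤ , ∈⊤) = ℕₚ.*-comm ∣E G ∣ n

      search : ∀ S → Acc _⊂_ S → Dense S → ∃[ S ] Dense S × (∀ {W} → W ⊂ S → ¬ Dense W)
      search S (acc rec) dense with anySubset? (λ W → (W ⊂? S) ×-dec dense? W)
      ... | yes (W , W⊂S , W-dense) = search W (rec W⊂S) W-dense
      ... | no  none                = S , dense , λ W⊂S W-dense → none (_ , W⊂S , W-dense)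

    -- Compared with the density of `U`, this bounds from below the edges inside `U` that are not
    -- inside `W`.
    minimal-dense-proper : ∀ {U} → (∀ {W} → W ⊂ U → ¬ Dense W) → ∀ {W} → W ⊂ U →
                           n * edgesInside W ≤ ∣E G ∣ * ∣ W ∣ᵛ
    minimal-dense-proper minimal {W} W⊂U with nonempty? W
    ... | yes W≠∅ = ℕₚ.≰⇒≥ λ W-dense → minimal W⊂U (W≠∅ , W-dense)
    ... | no  W=∅ rewrite #-empty (inside? W ∘ lookup (edges G)) (λ _ (u∈ , _) → W=∅ (_ , u∈))
                        | ℕₚ.*-zeroʳ n = z≤n

    -- Density and `edgesInside-bound` give d ≤ s - 1 for s the size of `S`, which exceeds the floor
    -- of d/2.
    dense-large : .{{_ : NonZero n}} → ∀ {S} → Dense S → ∣E G ∣ / n < ∣ S ∣ᵛ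
    dense-large {S} (S≠∅ , E∣S∣≤) = ℕₚ.*-cancelʳ-< n (∣E G ∣ / n) s (begin-strict
      ∣E G ∣ / n * n       ≤⟨ m/n*n≤m ∣E G ∣ n ⟩
      ∣E G ∣               ≤⟨ ℕₚ.m≤m+n ∣E G ∣ (∣E G ∣ + 0) ⟩
      2 * ∣E G ∣           <⟨ ℕₚ.m<m+n (2 * ∣E G ∣) (ℕₚ.n≢0⇒n>0 (≢-nonZero⁻¹ n)) ⟩
      2 * ∣E G ∣ + n       ≤⟨ ℕₚ.*-cancelʳ-≤ _ _ s {{>-nonZero 0<s}} scaled ⟩
      s * n                ∎)
      where
      open ℕₚ.≤-Reasoning
      s : ℕ
      s = ∣ S ∣ᵛ
      0<s : 0 < s
      0<s = #-positive (_∈? S) S≠∅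

      scaled : (2 * ∣E G ∣ + n) * s ≤ s * n * s
      scaled = begin
        (2 * ∣E G ∣ + n) * s           ≡⟨ lemma₁ ∣E G ∣ n s ⟩
        2 * (∣E G ∣ * s) + n * s       ≤⟨ ℕₚ.+-monoˡ-≤ (n * s) (ℕₚ.*-monoʳ-≤ 2 E∣S∣≤) ⟩
        2 * (n * edgesInside S) + n * s ≡⟨ lemma₂ n (edgesInside S) s ⟩
        n * (2 * edgesInside S + s)    ≤⟨ ℕₚ.*-monoʳ-≤ n (edgesInside-bound S) ⟩
        n * (s * s)                    ≡⟨ lemma₃ n s ⟩
        s * n * s                      ∎
        where
        lemma₁ : ∀ e n s → (2 * e + n) * s ≡ 2 * (e * s) + n * s
        lemma₁ = solve-∀
        lemma₂ : ∀ n e s → 2 * (n * e) + n * s ≡ n * (2 * e + s)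
        lemma₂ = solve-∀
        lemma₃ : ∀ n s → n * (s * s) ≡ s * n * s
        lemma₃ = solve-∀

-- Pairs of vertices of S with the same label.

module Parts {S : Pred (Fin n) ℓ} (S? : Decidable₁ S) (label : Fin n → Maybe (Fin N)) where
  open Counting
  open import Data.Nat.Base using (_+_; _*_; _∸_; _≤_; _<_)
  open import Data.Nat.Tactic.RingSolver using (solve-∀)

  InPart : Fin N → Fin n → Set ℓ
  InPart x v = S v × label v ≡ just x

  inPart? : ∀ x → Decidable₁ (InPart x)
  inPart? x v = S? v ×-dec ≡-dec _≟_ (label v) (just x)

  Mates : Fin n → Fin n → Set ℓ
  Mates u v = ∃[ x ] InPart x u × InPart x v

  mates? : ∀ u v → Dec (Mates u v)
  mates? u v = any? λ x → inPart? x u ×-dec inPart? x v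

  mates : Fin n → ℕ
  mates u = # λ v → ¬? (u ≟ v) ×-dec mates? u v

  mates-loner : ∀ {u} → (∀ {x} → ¬ InPart x u) → mates u ≡ 0
  mates-loner {u} loner = #-empty (λ v → ¬? (u ≟ v) ×-dec mates? u v)
    λ _ (_ , _ , u∈ , _) → loner u∈

  -- The label of `u` is unique, so all its mates lie in the part of `u`, and `u` is not its own
  -- mate.
  mates-part : ∀ {u x} → InPart x u → mates u < # (inPart? x)
  mates-part {u} {x} u∈x = ℕₚ.≤-<-trans
    (#-mono (λ (u≢v , y , (_ , u∈y) , (Sv , v∈y)) →
        u≢v , Sv , trans v∈y (trans (sym u∈y) (proj₂ u∈x)))
      (λ v → ¬? (u ≟ v) ×-dec mates? u v) (λ v → ¬? (u ≟ v) ×-dec inPart? x v))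
    (#-other (inPart? x) u∈x)

  mates-total : ∀ {c} → (∀ {u x} → InPart x u → mates u ≤ c) → sum mates ≤ # S? * c
  mates-total {c} bound = sum-bound S? on λ ¬Su → mates-loner (¬Su ∘ proj₁)
    where
    on : ∀ {u} → S u → mates u ≤ c
    on {u} _ with any? (λ x → inPart? x u)
    ... | yes (_ , u∈x) = bound u∈x
    ... | no  loner     = ℕₚ.≤-trans (ℕₚ.≤-reflexive (mates-loner λ u∈x → loner (_ , u∈x))) z≤n

  module _ {q : ℕ} (part≤q : ∀ x → # (inPart? x) ≤ q) where

    mates-total-large : sum mates ≤ # S? * (q ∸ 1)
    mates-total-large = mates-total λ {_} {x} u∈x →
      ℕₚ.<⇒≤pred (ℕₚ.<-≤-trans (mates-part u∈x) (part≤q x))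

    private
      -- If a part x had q elements, only one element of S would lie outside it.
      outsider-alone : # S? ≡ suc q → ∀ {x} → q ≤ # (inPart? x) →
                       ∀ {u} → ¬ InPart x u → mates u ≡ 0
      outsider-alone ∣S∣ {x} q≤ {u} u∉x =
        #-empty (λ v → ¬? (u ≟ v) ×-dec mates? u v) λ v (u≢v , y , u∈y , v∈y) →
          ℕₚ.<-irrefl refl (begin-strict
            # S?                              ≡⟨ ∣S∣ ⟩
            suc q                             ≤⟨ s≤s q≤ ⟩
            suc (# (inPart? x))               ≡⟨ ℕₚ.+-comm 1 _ ⟩
            # (inPart? x) + 1                 <⟨ ℕₚ.+-monoʳ-< (# (inPart? x)) (two u≢v u∈y v∈y) ⟩
            # (inPart? x) + # (outside? x)
              ≤⟨ #-disjoint proj₁ proj₁ (λ v∈x (_ , v∉x) → v∉x v∈x)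
                   (inPart? x) (outside? x) S? ⟩
            # S?                              ∎)
        where
        open ℕₚ.≤-Reasoning
        outside? : ∀ x v → Dec (S v × ¬ InPart x v)
        outside? x v = S? v ×-dec ¬? (inPart? x v)

        two : ∀ {v y} → u ≢ v → InPart y u → InPart y v → 1 < # (outside? x)
        two {v} u≢v (Su , u∈y) (Sv , v∈y) = ℕₚ.≤-<-trans
          (#-positive (λ w → ¬? (u ≟ w) ×-dec outside? x w)
            (v , u≢v , Sv , λ (_ , v∈x) → u∉x (Su , trans u∈y (trans (sym v∈y) v∈x))))
          (#-other (outside? x) (Su , u∉x))

    -- For this size `mates-total-large` gives only (q + 1)(q - 1); the sharper bound uses that a
    -- part of size q leaves a single vertex over.
    mates-total-tight : # S? ≡ suc q → sum mates ≤ q * (q ∸ 1)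
    mates-total-tight ∣S∣ with any? (λ x → q ℕₚ.≤? # (inPart? x))
    -- Only the members of the large part have mates: at most q members, each with at most q - 1.
    ... | yes (x , q≤) = ℕₚ.≤-trans
      (sum-bound (inPart? x) (λ u∈x → ℕₚ.<⇒≤pred (ℕₚ.<-≤-trans (mates-part u∈x) (part≤q x)))
        (outsider-alone ∣S∣ q≤))
      (ℕₚ.*-monoˡ-≤ (q ∸ 1) (part≤q x))
    -- Every part has fewer than q elements, so each vertex has at most q - 2 mates.
    ... | no small = begin
      sum mates         ≤⟨ mates-total (λ {_} {x} u∈x → ℕₚ.<⇒≤pred (ℕₚ.<-≤-trans (mates-part u∈x)
                             (ℕₚ.<⇒≤pred (ℕₚ.≰⇒> λ q≤ → small (x , q≤))))) ⟩
      # S? * (q ∸ 1 ∸ 1) ≡⟨ cong (_* (q ∸ 1 ∸ 1)) ∣S∣ ⟩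
      suc q * (q ∸ 1 ∸ 1) ≤⟨ monus q ⟩
      q * (q ∸ 1)       ∎
      where
      open ℕₚ.≤-Reasoning
      monus : ∀ q → suc q * (q ∸ 1 ∸ 1) ≤ q * (q ∸ 1)
      monus zero          = z≤n
      monus (suc zero)    = z≤n
      -- For q ≥ 2 the two sides differ by exactly 2; for smaller q truncated subtraction makes the
      -- left side zero.
      monus (suc (suc k)) = ℕₚ.≤-trans (ℕₚ.m≤m+n _ 2) (ℕₚ.≤-reflexive (lemma k))
        where
        lemma : ∀ k → suc (suc (suc k)) * k + 2 ≡ suc (suc k) * suc k
        lemma = solve-∀

-- Inequalities between natural numbers.

module Arithmetic where
  open import Data.Nat.Base using (_+_; _*_; _∸_; _≤_; _<_; _/_; _%_)
  open import Data.Nat.DivMod using (m≡m%n+[m/n]*n; m%n<n; m/n*n≤m)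
  open import Data.Nat.Tactic.RingSolver using (solve-∀)

  module _ {n : ℕ} .{{_ : NonZero n}} (E B : ℕ) where

    private
      q r : ℕ
      q = E / n
      r = E % n

    -- With x = E / n and fractional part ρ = x − q, the difference of the two
    -- sides divided by n² is at least 2 − ρ − ρ² = (1 − ρ) (2 + ρ) > 0.
    quadratic-bound : 2 * E * suc q ≤ 2 * n * B + n * (q * (q ∸ 1)) →
                      E * E + 3 * E * n < 2 * n * n * suc B
    quadratic-bound hyp = ℕₚ.+-cancelʳ-< (n * n * (q * q)) _ _ (begin-strict
      E * E + 3 * E * n + n * n * (q * q)
        <⟨ core r<n ⟩
      n * (2 * E * suc q) + n * n * q + 2 * n * n
        ≤⟨ ℕₚ.+-monoˡ-≤ _ (ℕₚ.+-monoˡ-≤ _ (ℕₚ.*-monoʳ-≤ n hyp)) ⟩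
      n * (2 * n * B + n * (q * (q ∸ 1))) + n * n * q + 2 * n * n
        ≡⟨ collect q ⟩
      2 * n * n * suc B + n * n * (q * q) ∎)
      where
      open ℕₚ.≤-Reasoning

      r<n : r < n
      r<n = m%n<n E n

      collect : ∀ q → n * (2 * n * B + n * (q * (q ∸ 1))) + n * n * q + 2 * n * n ≡
                      2 * n * n * suc B + n * n * (q * q)
      collect zero    = lemma n B
        where
        lemma : ∀ n B → n * (2 * n * B + n * 0) + n * n * 0 + 2 * n * n ≡
                        2 * n * n * suc B + n * n * 0
        lemma = solve-∀
      collect (suc k) = lemma n B k
        where
        lemma : ∀ n B k → n * (2 * n * B + n * (suc k * k)) + n * n * suc k + 2 * n * n ≡
                          2 * n * n * suc B + n * n * (suc k * suc k)
        lemma = solve-∀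

      -- With n = r + k + 1, the slack `suc k * (2 * n + r)` is (n - r)(2n + r).
      identity : ∀ r k q → let n = suc (r + k); E = r + q * n in
        n * (2 * E * suc q) + n * n * q + 2 * n * n ≡
        E * E + 3 * E * n + n * n * (q * q) + suc k * (2 * n + r)
      identity = solve-∀

      core : r < n → E * E + 3 * E * n + n * n * (q * q) <
                     n * (2 * E * suc q) + n * n * q + 2 * n * n
      core r<n with ℕₚ.m≤n⇒∃[o]m+o≡n r<n
      ... | k , n≡ = subst₂
        (λ n E → E * E + 3 * E * n + n * n * (q * q) <
                 n * (2 * E * suc q) + n * n * q + 2 * n * n)
        n≡
        (trans (cong (λ n → r + q * n) n≡) (sym (m≡m%n+[m/n]*n E n)))
        (ℕₚ.<-≤-trans (ℕₚ.m<m+n _ (ℕₚ.0<1+n)) (ℕₚ.≤-reflexive (sym (identity r k q))))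

    -- Reduces a larger S to the inequality for size q + 1. With s = q + 2 + k, the k + 1 extra
    -- vertices account for 2E(k + 1) on the left, and the extra mates for at most n(k + 2)(q - 1)
    -- on the right. The former is at least the latter, since n(q - 1) ≤ E and k + 2 ≤ 2(k + 1).
    part-bound : ∀ {s P} → suc q < s → P ≤ s * (q ∸ 1) → 2 * E * s ≤ 2 * n * B + n * P →
                 2 * E * suc q ≤ 2 * n * B + n * (q * (q ∸ 1))
    part-bound {s} {P} q<s P≤ hyp with ℕₚ.m≤n⇒∃[o]m+o≡n q<s
    ... | k , refl = ℕₚ.+-cancelʳ-≤ (2 * E * suc k) _ _ (begin
      2 * E * suc q + 2 * E * suc k            ≡⟨ lemma₁ E q k ⟩
      2 * E * (suc (suc q) + k)                ≤⟨ hyp ⟩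
      2 * n * B + n * P                        ≤⟨ ℕₚ.+-monoʳ-≤ _ (ℕₚ.*-monoʳ-≤ n P≤) ⟩
      2 * n * B + n * ((suc (suc q) + k) * c)  ≡⟨ lemma₂ n B q k c ⟩
      2 * n * B + n * (q * c) + (2 + k) * (c * n)
        ≤⟨ ℕₚ.+-monoʳ-≤ (2 * n * B + n * (q * c)) (ℕₚ.*-mono-≤ 2+k≤ cn≤E) ⟩
      2 * n * B + n * (q * c) + 2 * suc k * E  ≡⟨ cong (2 * n * B + n * (q * c) +_) (lemma₃ E k) ⟩
      2 * n * B + n * (q * c) + 2 * E * suc k  ∎)
      where
      open ℕₚ.≤-Reasoning
      c : ℕ
      c = q ∸ 1
      cn≤E : c * n ≤ E
      cn≤E = ℕₚ.≤-trans (ℕₚ.*-monoˡ-≤ n (ℕₚ.m∸n≤m q 1)) (m/n*n≤m E n)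
      2+k≤ : 2 + k ≤ 2 * suc k
      2+k≤ = ℕₚ.≤-trans (s≤s (ℕₚ.≤-reflexive (ℕₚ.+-comm 1 k))) (s≤s (ℕₚ.+-monoʳ-≤ k (s≤s z≤n)))
      lemma₁ : ∀ E q k → 2 * E * suc q + 2 * E * suc k ≡ 2 * E * (suc (suc q) + k)
      lemma₁ = solve-∀
      lemma₂ : ∀ n B q k c → 2 * n * B + n * ((suc (suc q) + k) * c) ≡
               2 * n * B + n * (q * c) + (2 + k) * (c * n)
      lemma₂ = solve-∀
      lemma₃ : ∀ E k → 2 * suc k * E ≡ 2 * E * suc k
      lemma₃ = solve-∀

-- The lower bound on the largest bag.

module MaxBag where
  open TreeWalks
  open Counting
  open DenseSubsets
  open Arithmetic
  open import Data.Fin.Subset using (Subset; ∣_∣; _∈_; _⊂_)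
  open import Data.Fin.Subset.Properties using (_∈?_)
  open import Data.List.Extrema.Nat using (xs≤max)
  import Data.List.Relation.Unary.All.Properties as Allₚ
  open import Data.Nat.Base using (_+_; _*_; _∸_; _≤_; _<_; _/_; ≢-nonZero⁻¹)
  open import Data.Nat.Tactic.RingSolver using (solve-∀)

  bag≤maxBagSize : {H : Graph n} (td : TreeDecomposition H) →
                   ∀ t → ∣ TreeDecomposition.bag td t ∣ ℕ.≤ TreeDecomposition.maxBagSize td
  bag≤maxBagSize td t = Allₚ.tabulate⁻ (xs≤max 0 _) t

  module _ .{{_ : NonZero n}} (G : Graph n) (td : TreeDecomposition (L G)) where
    open TreeDecomposition td
    open Labelling G td

    private
      E q : ℕ
      E = ∣E G ∣
      q = E / n

    away? : ∀ (U : Subset n) t p v → Dec (v ∈ U × label t v ≢ just p)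
    away? U t p v = (v ∈? U) ×-dec ¬? (≡-dec _≟_ (label t v) (just p))

    -- The bag of the node at which the search stops.

    module LargeBag
      {U : Subset n} (U-dense : Dense G U) (minimal : ∀ {W} → W ⊂ U → ¬ Dense G W)
      {t p : Node} (heavy : q < # (away? U t p))
      (light : ∀ {x} → Adj tree t x → x ≢ p → ¬ q < # (away? U x t))
      where

      S? : ∀ v → Dec (v ∈ U × label t v ≢ just p)
      S? = away? U t p

      open Parts S? (label t)

      -- No vertex of S is labelled `p`, and labels are neighbours of `t`. For any other neighbour
      -- `x`, the vertices labelled `x` at `t` are not labelled `t` at `x`, so lightness bounds
      -- their number.
      part≤q : ∀ x → # (inPart? x) ≤ q
      part≤q x with x ≟ p | adj? tree t x
      ... | yes refl | _      = ℕₚ.≤-trans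
        (ℕₚ.≤-reflexive (#-empty (inPart? x) λ _ ((_ , ≢p) , ≡p) → ≢p ≡p)) z≤n
      ... | _        | no ¬tx = ℕₚ.≤-trans
        (ℕₚ.≤-reflexive (#-empty (inPart? x) λ _ (_ , eq) → ¬tx (label-neighbour eq))) z≤n
      ... | no x≢p   | yes tx = ℕₚ.≤-trans
        (#-mono (λ ((v∈U , _) , eq) → v∈U , label-opposite eq)
          (inPart? x) (away? U x t))
        (ℕₚ.≮⇒≥ (light tx x≢p))

      rest? : ∀ v → Dec (v ∈ U × label t v ≡ just p)
      rest? v = (v ∈? U) ×-dec ≡-dec _≟_ (label t v) (just p)

      -- The complement of S in `U`.
      W : Subset n
      W = comprehension rest?

      W⊂U : W ⊂ U
      W⊂U = proj₁ ∘ ∈-comprehension⁻ rest? ,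
        (let v , v∈U , v∉p = #-inhabited S? (ℕₚ.≤-<-trans z≤n heavy) in
         v , v∈U , v∉p ∘ proj₂ ∘ ∈-comprehension⁻ rest?)

      matedEdge? : ∀ e → Dec (uncurry Mates (lookup (edges G) e))
      matedEdge? e = uncurry mates? (lookup (edges G) e)

      -- An edge missing from the bag lies on one side `x` of `t`, so both its ends bear the label
      -- `x`. They lie in `W` if `x` is `p`, and are mates otherwise.
      edge-cover : ∀ {e} → let u , v = lookup (edges G) e in u ∈ U × v ∈ U →
                   (u ∈ W × v ∈ W) ⊎ (e ∈ bag t ⊎ Mates u v)
      edge-cover {e} (u∈U , v∈U) with e ∈? bag t
      ... | yes e∈t = inj₂ (inj₁ e∈t)
      ... | no  e∉t with side-exists e∉t
      ...   | x , sd with x ≟ p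
      ...     | yes refl = inj₁
        ( ∈-comprehension⁺ rest? (u∈U , side-label (inj₁ refl) sd)
        , ∈-comprehension⁺ rest? (v∈U , side-label (inj₂ refl) sd) )
      ...     | no  x≢p  = inj₂ (inj₂
        ( x
        , member u∈U (side-label (inj₁ refl) sd)
        , member v∈U (side-label (inj₂ refl) sd) ))
        where
        member : ∀ {v} → v ∈ U → label t v ≡ just x → InPart x v
        member v∈U eq = (v∈U , λ eq′ → x≢p (just-injective (trans (sym eq) eq′))) , eq

      B K : ℕ
      B = ∣ bag t ∣
      K = # matedEdge?

      edges-split : edgesInside G U ≤ edgesInside G W + (B + K)
      edges-split = begin
        edgesInside G U
          ≤⟨ #-split edge-cover (inside? G U ∘ lookup (edges G)) (inside? G W ∘ lookup (edges G))
               bagOrMated? ⟩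
        edgesInside G W + # bagOrMated?
          ≤⟨ ℕₚ.+-monoʳ-≤ (edgesInside G W) (#-split id bagOrMated? (_∈? bag t) matedEdge?) ⟩
        edgesInside G W + (# (_∈? bag t) + K)
          ≤⟨ ℕₚ.+-monoʳ-≤ (edgesInside G W) (ℕₚ.+-monoˡ-≤ K (#-∈ (bag t))) ⟩
        edgesInside G W + (B + K)
          ∎
        where
        open ℕₚ.≤-Reasoning
        bagOrMated? : ∀ e → Dec (e ∈ bag t ⊎ uncurry Mates (lookup (edges G) e))
        bagOrMated? e = (e ∈? bag t) ⊎-dec matedEdge? e

      vertices-split : # S? + ∣ W ∣ᵛ ≤ ∣ U ∣ᵛ
      vertices-split = #-disjoint proj₁ (proj₁ ∘ ∈-comprehension⁻ rest?)
        (λ (_ , v∉p) v∈W → v∉p (proj₂ (∈-comprehension⁻ rest? v∈W))) S? (_∈? W) (_∈? U)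

      -- Subtract the upper bound for edges inside the proper subset `W` from the lower bound for
      -- edges inside `U`; what remains is in the bag or joins mates.
      incident-edges : E * # S? ≤ n * (B + K)
      incident-edges = ℕₚ.+-cancelʳ-≤ (E * ∣ W ∣ᵛ) _ _ (begin
        E * # S? + E * ∣ W ∣ᵛ              ≡⟨ ℕₚ.*-distribˡ-+ E (# S?) ∣ W ∣ᵛ ⟨
        E * (# S? + ∣ W ∣ᵛ)                ≤⟨ ℕₚ.*-monoʳ-≤ E vertices-split ⟩
        E * ∣ U ∣ᵛ                         ≤⟨ proj₂ U-dense ⟩
        n * edgesInside G U                ≤⟨ ℕₚ.*-monoʳ-≤ n edges-split ⟩
        n * (edgesInside G W + (B + K))    ≡⟨ ℕₚ.*-distribˡ-+ n (edgesInside G W) (B + K) ⟩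
        n * edgesInside G W + n * (B + K)
          ≤⟨ ℕₚ.+-monoˡ-≤ (n * (B + K)) (minimal-dense-proper G minimal W⊂U) ⟩
        E * ∣ W ∣ᵛ + n * (B + K)           ≡⟨ ℕₚ.+-comm (E * ∣ W ∣ᵛ) _ ⟩
        n * (B + K) + E * ∣ W ∣ᵛ           ∎)
        where open ℕₚ.≤-Reasoning

      bag-and-mates : 2 * E * # S? ≤ 2 * n * B + n * sum mates
      bag-and-mates = begin
        2 * E * # S?            ≡⟨ ℕₚ.*-assoc 2 E (# S?) ⟩
        2 * (E * # S?)          ≤⟨ ℕₚ.*-monoʳ-≤ 2 incident-edges ⟩
        2 * (n * (B + K))       ≡⟨ lemma n B K ⟩
        2 * n * B + n * (2 * K)
          ≤⟨ ℕₚ.+-monoʳ-≤ (2 * n * B)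
               (ℕₚ.*-monoʳ-≤ n (twice-edge-count G mates? λ (x , u∈ , v∈) → x , v∈ , u∈)) ⟩
        2 * n * B + n * sum mates ∎
        where
        open ℕₚ.≤-Reasoning
        lemma : ∀ n b k → 2 * (n * (b + k)) ≡ 2 * n * b + n * (2 * k)
        lemma = solve-∀

      bag-bound : 2 * E * suc q ≤ 2 * n * B + n * (q * (q ∸ 1))
      bag-bound with ℕₚ.m≤n⇒m<n∨m≡n heavy
      ... | inj₁ 1+q<s = part-bound E B 1+q<s (mates-total-large part≤q) bag-and-mates
      ... | inj₂ 1+q≡s = ℕₚ.≤-trans
        (subst (λ s → 2 * E * s ≤ 2 * n * B + n * sum mates) (sym 1+q≡s) bag-and-mates)
        (ℕₚ.+-monoʳ-≤ (2 * n * B) (ℕₚ.*-monoʳ-≤ n (mates-total-tight part≤q (sym 1+q≡s))))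

    maxBagSize-bound : E * E + 3 * E * n < 2 * n * n * suc maxBagSize
    maxBagSize-bound =
      let U , U-dense , minimal = minimal-dense G
          t , p , heavy , light = non-backtracking-search tree acyclic heavy? (root U U-dense)
      in ℕₚ.<-≤-trans
        (quadratic-bound E ∣ bag t ∣ (LargeBag.bag-bound U-dense minimal heavy light))
        (ℕₚ.*-monoʳ-≤ (2 * n * n) (s≤s (bag≤maxBagSize td t)))
      where
      open IsTree isTree using (acyclic; nonempty)

      heavy? : ∀ {U} t p → Dec (q < # (away? U t p))
      heavy? {U} t p = q ℕₚ.<? # (away? U t p)

      -- A label at `r` is a neighbour of `r`, never `r` itself, so S is initially all of `U`.
      root : ∀ U → Dense G U → ∃[ r ] q < # (away? U r r)
      root U U-dense = r , ℕₚ.<-≤-trans (dense-large G U-dense)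
        (#-mono (λ v∈U → v∈U , λ eq → adj-irrefl tree refl (label-neighbour eq))
          (_∈? U) (away? U r r))
        where
        r : Node
        r = Fin.fromℕ< (ℕₚ.n≢0⇒n>0 (≢-nonZero⁻¹ order {{nonempty}}))

-- Passage to rational numbers, and the theorem.

open import Data.Integer.Base as ℤ using (ℤ; +_)
open import Data.Integer.Tactic.RingSolver using (solve-∀)
import Data.Integer.Properties as ℤₚ
open import Data.Rational.Base using (ℚ; _/_; _+_; _*_; _-_; -_; _<_; _>_; toℚᵘ)
import Data.Rational.Properties as ℚₚ
open import Data.Rational.Unnormalised.Base as ℚᵘ using (ℚᵘ; mkℚᵘ; _≃_; *<*)
import Data.Rational.Unnormalised.Properties as ℚᵘₚ

toℚᵘ-/ : ∀ i n .{{_ : NonZero n}} → toℚᵘ (i / n) ≃ i ℚᵘ./ n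
toℚᵘ-/ i (suc n) = ℚₚ.toℚᵘ-fromℚᵘ (mkℚᵘ i n)

toℚᵘ-homo-- : ∀ p q → toℚᵘ (p - q) ≃ toℚᵘ p ℚᵘ.- toℚᵘ q
toℚᵘ-homo-- p q = ℚᵘₚ.≃-trans (ℚₚ.toℚᵘ-homo-+ p (- q)) (ℚᵘₚ.+-congʳ (toℚᵘ p) (ℚₚ.toℚᵘ-homo‿- q))

-- Since d = 2E/n, the sum of the quadratic and linear terms is (E² + 3En) / (2n²); moving -2 across
-- turns M - 1 into M + 1. Unnormalised fractions keep numerators and denominators explicit for
-- cross-multiplication.
rational-bound : ∀ {n} .{{_ : NonZero n}} (E M : ℕ) →
  E ℕ.* E ℕ.+ 3 ℕ.* E ℕ.* n ℕ.< 2 ℕ.* n ℕ.* n ℕ.* suc M →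
  let d = (+ (2 ℕ.* E)) / n in
  ((+ 1 / 8) * (d * d) + (+ 3 / 4) * d) - (+ 2 / 1) < (+ M ℤ.- + 1) / 1
rational-bound {n@(suc n-1)} E M hyp = ℚₚ.toℚᵘ-cancel-< (begin-strict
  toℚᵘ (((+ 1 / 8) * (d * d) + (+ 3 / 4) * d) - (+ 2 / 1))
    ≃⟨ toℚᵘ-homo-- ((+ 1 / 8) * (d * d) + (+ 3 / 4) * d) (+ 2 / 1) ⟩
  toℚᵘ ((+ 1 / 8) * (d * d) + (+ 3 / 4) * d) ℚᵘ.- toℚᵘ (+ 2 / 1)
    ≃⟨ ℚᵘₚ.+-congˡ (ℚᵘ.- toℚᵘ (+ 2 / 1)) (ℚₚ.toℚᵘ-homo-+ ((+ 1 / 8) * (d * d)) ((+ 3 / 4) * d)) ⟩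
  (toℚᵘ ((+ 1 / 8) * (d * d)) ℚᵘ.+ toℚᵘ ((+ 3 / 4) * d)) ℚᵘ.- toℚᵘ (+ 2 / 1)
    ≃⟨ ℚᵘₚ.+-congˡ (ℚᵘ.- toℚᵘ (+ 2 / 1)) (ℚᵘₚ.+-cong quadratic linear) ⟩
  boundᵘ
    <⟨ *<* cross ⟩
  mkℚᵘ (+ M ℤ.- + 1) 0
    ≃⟨ toℚᵘ-/ (+ M ℤ.- + 1) 1 ⟨
  toℚᵘ ((+ M ℤ.- + 1) / 1) ∎)
  where
  open ℚᵘₚ.≤-Reasoning
  d : ℚ
  d = (+ (2 ℕ.* E)) / n
  dᵘ boundᵘ : ℚᵘ
  dᵘ = mkℚᵘ (+ (2 ℕ.* E)) n-1
  boundᵘ = (mkℚᵘ (+ 1) 7 ℚᵘ.* (dᵘ ℚᵘ.* dᵘ) ℚᵘ.+ mkℚᵘ (+ 3) 3 ℚᵘ.* dᵘ) ℚᵘ.- mkℚᵘ (+ 2) 0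

  d≃ : toℚᵘ d ≃ dᵘ
  d≃ = toℚᵘ-/ (+ (2 ℕ.* E)) n

  quadratic : toℚᵘ ((+ 1 / 8) * (d * d)) ≃ mkℚᵘ (+ 1) 7 ℚᵘ.* (dᵘ ℚᵘ.* dᵘ)
  quadratic = ℚᵘₚ.≃-trans (ℚₚ.toℚᵘ-homo-* (+ 1 / 8) (d * d))
    (ℚᵘₚ.*-congˡ (ℚᵘₚ.≃-trans (ℚₚ.toℚᵘ-homo-* d d) (ℚᵘₚ.*-cong d≃ d≃)))

  linear : toℚᵘ ((+ 3 / 4) * d) ≃ mkℚᵘ (+ 3) 3 ℚᵘ.* dᵘ
  linear = ℚᵘₚ.≃-trans (ℚₚ.toℚᵘ-homo-* (+ 3 / 4) d) (ℚᵘₚ.*-congˡ d≃)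

  -- Cross-multiplied, each side is 16 n times a side of hyp, shifted by 4 n².
  cross : ℚᵘ.↥ boundᵘ ℤ.* + 1 ℤ.< (+ M ℤ.- + 1) ℤ.* ℚᵘ.↧ boundᵘ
  cross = subst₂ ℤ._<_ (sym left) (sym right)
    (ℤₚ.*-monoˡ-<-pos (+ 16 ℤ.* + n) (ℤₚ.+-monoˡ-< (ℤ.- (+ 4 ℤ.* + n ℤ.* + n)) (ℤ.+<+ hyp)))
    where
    -- The form to which the numerator of `boundᵘ` unfolds, with its natural-number products
    -- abstracted so that they can be rewritten as integer products.
    numerator : ℤ → ℤ → ℤ → ℤ → ℤ
    numerator a b c f =
      (((+ 1 ℤ.* (a ℤ.* a)) ℤ.* b ℤ.+ (+ 3 ℤ.* a) ℤ.* c) ℤ.* + 1 ℤ.+ (ℤ.- + 2) ℤ.* f) ℤ.* + 1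

    left₁ : ∀ e n →
      (((+ 1 ℤ.* ((+ 2 ℤ.* e) ℤ.* (+ 2 ℤ.* e))) ℤ.* (+ 4 ℤ.* n)
        ℤ.+ (+ 3 ℤ.* (+ 2 ℤ.* e)) ℤ.* (+ 8 ℤ.* (n ℤ.* n))) ℤ.* + 1
        ℤ.+ (ℤ.- + 2) ℤ.* (+ 8 ℤ.* (n ℤ.* n) ℤ.* (+ 4 ℤ.* n))) ℤ.* + 1 ≡
      + 16 ℤ.* n ℤ.* ((e ℤ.* e ℤ.+ + 3 ℤ.* e ℤ.* n) ℤ.- + 4 ℤ.* n ℤ.* n)
    left₁ = solve-∀
    right₁ : ∀ m n →
      (m ℤ.- + 1) ℤ.* (+ 8 ℤ.* (n ℤ.* n) ℤ.* (+ 4 ℤ.* n) ℤ.* + 1) ≡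
      + 16 ℤ.* n ℤ.* ((+ 2 ℤ.* n ℤ.* n ℤ.* (+ 1 ℤ.+ m)) ℤ.- + 4 ℤ.* n ℤ.* n)
    right₁ = solve-∀

    twice : + (2 ℕ.* E) ≡ + 2 ℤ.* + E
    twice = ℤₚ.pos-* 2 E
    den₁ : + (8 ℕ.* (n ℕ.* n)) ≡ + 8 ℤ.* (+ n ℤ.* + n)
    den₁ = trans (ℤₚ.pos-* 8 (n ℕ.* n)) (cong (+ 8 ℤ.*_) (ℤₚ.pos-* n n))
    den : + (8 ℕ.* (n ℕ.* n) ℕ.* (4 ℕ.* n)) ≡ + 8 ℤ.* (+ n ℤ.* + n) ℤ.* (+ 4 ℤ.* + n)
    den = trans (ℤₚ.pos-* (8 ℕ.* (n ℕ.* n)) (4 ℕ.* n)) (cong₂ ℤ._*_ den₁ (ℤₚ.pos-* 4 n))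

    left : numerator (+ (2 ℕ.* E)) (+ (4 ℕ.* n)) (+ (8 ℕ.* (n ℕ.* n)))
             (+ (8 ℕ.* (n ℕ.* n) ℕ.* (4 ℕ.* n))) ≡
           + 16 ℤ.* + n ℤ.* (+ (E ℕ.* E ℕ.+ 3 ℕ.* E ℕ.* n) ℤ.- + 4 ℤ.* + n ℤ.* + n)
    left = trans
      (trans (cong₂ (λ a b → numerator a b (+ (8 ℕ.* (n ℕ.* n)))
                               (+ (8 ℕ.* (n ℕ.* n) ℕ.* (4 ℕ.* n)))) twice (ℤₚ.pos-* 4 n))
             (cong₂ (numerator (+ 2 ℤ.* + E) (+ 4 ℤ.* + n)) den₁ den))
      (trans (left₁ (+ E) (+ n))
             (cong (λ x → + 16 ℤ.* + n ℤ.* (x ℤ.- + 4 ℤ.* + n ℤ.* + n)) (sym lower)))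
      where
      lower : + (E ℕ.* E ℕ.+ 3 ℕ.* E ℕ.* n) ≡ + E ℤ.* + E ℤ.+ + 3 ℤ.* + E ℤ.* + n
      lower = cong₂ ℤ._+_ (ℤₚ.pos-* E E)
        (trans (ℤₚ.pos-* (3 ℕ.* E) n) (cong (ℤ._* + n) (ℤₚ.pos-* 3 E)))

    right : (+ M ℤ.- + 1) ℤ.* + (8 ℕ.* (n ℕ.* n) ℕ.* (4 ℕ.* n) ℕ.* 1) ≡
            + 16 ℤ.* + n ℤ.* (+ (2 ℕ.* n ℕ.* n ℕ.* suc M) ℤ.- + 4 ℤ.* + n ℤ.* + n)
    right = trans
      (cong ((+ M ℤ.- + 1) ℤ.*_)
        (trans (ℤₚ.pos-* (8 ℕ.* (n ℕ.* n) ℕ.* (4 ℕ.* n)) 1) (cong (ℤ._* + 1) den)))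
      (trans (right₁ (+ M) (+ n))
             (cong (λ x → + 16 ℤ.* + n ℤ.* (x ℤ.- + 4 ℤ.* + n ℤ.* + n)) (sym upper)))
      where
      upper : + (2 ℕ.* n ℕ.* n ℕ.* suc M) ≡ + 2 ℤ.* + n ℤ.* + n ℤ.* (+ 1 ℤ.+ + M)
      upper = trans (ℤₚ.pos-* (2 ℕ.* n ℕ.* n) (suc M))
        (cong (ℤ._* + suc M) (trans (ℤₚ.pos-* (2 ℕ.* n) n) (cong (ℤ._* + n) (ℤₚ.pos-* 2 n))))

theorem1p1 : ∀ {n : ℕ} .{{_ : NonZero n}} (G : Graph n) (pw tw : ℤ) →
    IsPathwidth (L G) pw → IsTreewidth (L G) tw →
    let d = averageDegree G in
    (pw ℤ.≥ tw) ×
    ((tw / 1) > (((+ 1) / 8) * (d * d) + ((+ 3) / 4) * d) - ((+ 2) / 1))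
theorem1p1 G pw tw ((pd , refl) , _) ((td , refl) , tw-minimal) =
  -- An optimal path decomposition is in particular a tree decomposition.
  tw-minimal (proj₁ pd) ,
  rational-bound ∣E G ∣ (TreeDecomposition.maxBagSize td) (MaxBag.maxBagSize-bound G td)
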